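{- Let $m$ be a positive integer with $m\not\equiv 2\pmod 3$. Then the function $f:\mathbb{F}_{2^{3m}}\to\mathbb{F}_{2^{3m}}$, $$f(x)=x^{2^m+1}+x^{2^{2m}+2^m},$$ is pseudo-planar on $\mathbb{F}_{2^{3m}}$.
   Context: A function $f:\mathbb{F}_{2^n}\to\mathbb{F}_{2^n}$ is called pseudo-planar if for every $\epsilon\in\mathbb{F}_{2^n}^*$ the map $x\mapsto f(x+\epsilon)+f(x)+\epsilon x$ is a permutation of $\mathbb{F}_{2^n}$. -}

module Defs where

open import Algebra.Apartness.Bundles using (HeytingField; HeytingCommutativeRing)
open import Algebra.Bundles using (CommutativeRing)
import Algebra.Properties.Semiring.Exp as Exp
open import Data.Fin.Base using (Fin)
open import Data.Nat.Base as ℕ using (ℕ)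
open import Function.Bundles using (Inverse)
open import Function.Structures using (IsBijection)
open import Level using (Level; _⊔_; suc)
open import Relation.Binary.PropositionalEquality using (setoid)

private
  variable
    c ℓ₁ ℓ₂ : Level

-- A field with exactly 2 ^ n elements, counted up to the field's own equality
-- _≈_.  The enumeration makes _≈_ decidable, so "nonzero", "apart from zero"
-- and "invertible" all agree.  Characteristic 2 is a consequence, not a field
-- of the record.
record BinaryField (c ℓ₁ ℓ₂ : Level) (n : ℕ) : Set (suc (c ⊔ ℓ₁ ⊔ ℓ₂)) where
  field
    heytingField : HeytingField c ℓ₁ ℓ₂

  open HeytingField heytingField public
    using (_#_; isHeytingField; heytingCommutativeRing)

  commutativeRing : CommutativeRing c ℓ₁
  commutativeRing = HeytingCommutativeRing.commutativeRing heytingCommutativeRing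

  open CommutativeRing commutativeRing public
    hiding (setoid)

  open Exp semiring public
    using (_^_)

  field
    enumeration : Inverse (CommutativeRing.setoid commutativeRing)
                          (setoid (Fin (2 ℕ.^ n)))

-- IsBijection also asks that the map respect _≈_, i.e. that it be a function
-- on the field's elements.
PseudoPlanar : ∀ {n} (F : BinaryField c ℓ₁ ℓ₂ n) →
               (BinaryField.Carrier F → BinaryField.Carrier F) → Set (c ⊔ ℓ₁)
PseudoPlanar F f = ∀ ε → ε ≉ 0# →
  IsBijection _≈_ _≈_ (λ x → f (x + ε) + f x + ε * x)
  where open BinaryField F

{-# OPTIONS --safe #-}
module Submission where

-- Write σ x = x^(2^m), so σ³ = id, and (a, b, c) = (ε, σ ε, σ² ε).  In
-- characteristic 2 the difference map is affine with linear part
-- L u = (a + b) u + (a + c) σ u + b σ² u.  The determinant of L, σ L, σ² L in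
-- the unknowns u, σ u, σ² u is
--   a³ + b³ + c³ + a² c + b² a + c² b + a b c,
-- which is the norm from 𝔽₈ to 𝔽₂ of a + α b + α⁵ c, where α³ = α + 1; here
-- 𝔽₈ lies in the field since its degree is divisible by 3.  A vanishing
-- factor ε + α σ ε + α⁵ σ² ε = 0 gives, together with its images under σ, a
-- linear system in ε, σ ε, σ² ε whose determinant is α⁶ when m ≡ 0 and 1 when
-- m ≡ 1 modulo 3, forcing ε = 0.

open import Defs
open import Algebra.Apartness.Bundles using (HeytingField)
open import Algebra.Bundles using (CommutativeRing)
open import Algebra.Solver.Ring.AlmostCommutativeRing
  using (AlmostCommutativeRing; fromCommutativeSemiring; _-Raw-AlmostCommutative⟶_)
import Algebra.Properties.AbelianGroup as AbelianGroupProperties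
import Algebra.Properties.CommutativeMonoid.Sum as Sum
import Algebra.Properties.CommutativeSemiring.Exp as CommutativeExp
import Algebra.Properties.Monoid.Mult as Multiple
import Algebra.Properties.Ring as RingProperties
import Algebra.Properties.Semiring.Exp as Exp
import Algebra.Properties.Semiring.Mult as SemiringMult
import Algebra.Solver.Ring as RingSolver
open import Data.Bool.Base using (Bool; true; false; if_then_else_)
import Data.Bool.Properties as Bool
open import Data.Fin.Base using (Fin; zero; suc; inject≤; punchIn; punchOut)
open import Data.Fin.Permutation using (Permutation; permutation)
import Data.Fin.Properties as Fin
open import Data.Maybe.Base using (Maybe; just; nothing)
open import Data.Nat.Base as ℕ using (ℕ; zero; suc; NonZero)
open import Data.Nat.DivMod using (_%_; _/_; m≡m%n+[m/n]*n; m%n<n)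
import Data.Nat.Properties as ℕ
open import Data.Nat.Solver using (module +-*-Solver)
open import Data.Product.Base using (∃-syntax; _×_; _,_; proj₁; proj₂)
open import Data.Sum.Base using (_⊎_; inj₁; inj₂; [_,_]′)
open import Data.Vec.Functional using (removeAt)
open import Function.Base using (_∘_)
open import Function.Bundles using (Inverse)
open import Function.Definitions using (Congruent; Injective; Surjective)
open import Level using (Level; _⊔_)
open import Relation.Binary.Definitions using (Decidable)
open import Relation.Binary.PropositionalEquality as ≡ using (_≡_; _≢_)
import Relation.Binary.Reasoning.Setoid as SetoidReasoning
open import Relation.Nullary.Decidable using (yes; no; map′)
open import Relation.Nullary.Negation using (contradiction)

private
  variable
    c ℓ₁ ℓ₂ : Level

-- Injective self-maps of finite sets.

Fin-injective⇒surjective : ∀ {n} {f : Fin n → Fin n} → Injective _≡_ _≡_ f →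
                           ∀ j → ∃[ i ] f i ≡ j
Fin-injective⇒surjective {suc n} {f} inj j with Fin.any? (λ i → f i Fin.≟ j)
... | yes hit  = hit
-- Pigeonhole: punching the missed value `j` out of the codomain would inject `Fin (suc n)` into
-- `Fin n`.
... | no  miss = contradiction (Fin.injective⇒≤ punched-injective) ℕ.1+n≰n
  where
  j≢f : ∀ i → j ≢ f i
  j≢f i j≡fi = miss (i , ≡.sym j≡fi)

  punched-injective : Injective _≡_ _≡_ (λ i → punchOut (j≢f i))
  punched-injective {x} {y} eq = inj (Fin.punchOut-injective (j≢f x) (j≢f y) eq)

Fin-injective⇒permutation : ∀ {n} (f : Fin n → Fin n) → Injective _≡_ _≡_ f → Permutation n n
Fin-injective⇒permutation f inj =
  permutation f (proj₁ ∘ surj) (proj₂ ∘ surj) (λ i → inj (proj₂ (surj (f i))))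
  where surj = Fin-injective⇒surjective inj

-- Finite commutative rings and Fermat's identity.

module FiniteRing (R : CommutativeRing c ℓ₁) {N : ℕ}
  (finite : Inverse (CommutativeRing.setoid R) (≡.setoid (Fin N))) where

  open CommutativeRing R hiding (zero)
  open Inverse finite
  open Exp semiring using (_^_; ^-congˡ)
  open SetoidReasoning setoid
  open AbelianGroupProperties +-abelianGroup
    using () renaming (∙-cancelˡ to +-cancelˡ; ∙-cancelʳ to +-cancelʳ; x∙y⁻¹≈ε⇒x≈y to x-y≈0⇒x≈y)
  open RingProperties ring using ([y-z]x≈yx-zx)
  module Σ = Sum +-commutativeMonoid
  module Π = Sum *-commutativeMonoid
  open Multiple +-monoid using () renaming (_×_ to _·_)

  to-injective : ∀ {x y} → to x ≡ to y → x ≈ y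
  to-injective {x} {y} eq = begin
    x            ≈⟨ strictlyInverseʳ x ⟨
    from (to x)  ≈⟨ from-cong eq ⟩
    from (to y)  ≈⟨ strictlyInverseʳ y ⟩
    y            ∎

  from-injective : Injective _≡_ _≈_ from
  from-injective {i} {j} eq =
    ≡.trans (≡.sym (strictlyInverseˡ i)) (≡.trans (to-cong eq) (strictlyInverseˡ j))

  infix 4 _≟_

  _≟_ : Decidable _≈_
  x ≟ y = map′ to-injective to-cong (to x Fin.≟ to y)

  module _ {g : Carrier → Carrier} (g-cong : Congruent _≈_ _≈_ g) (g-inj : Injective _≈_ _≈_ g) where

    onIndices-injective : Injective _≡_ _≡_ (to ∘ g ∘ from)
    onIndices-injective eq = from-injective (g-inj (to-injective eq))

    onIndices : Permutation N N
    onIndices = Fin-injective⇒permutation (to ∘ g ∘ from) onIndices-injective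

    injective⇒surjective : Surjective _≈_ _≈_ g
    injective⇒surjective y with Fin-injective⇒surjective onIndices-injective (to y)
    ... | i , eq = from i , λ z≈fi → trans (g-cong z≈fi) (to-injective eq)

  -- Translation by `1#` permutes the ring, so the sum of all elements is unchanged when `1#` is
  -- added to each of its `N` terms.
  N·1≈0 : N · 1# ≈ 0#
  N·1≈0 = +-cancelˡ _ _ _ (begin
    Σ.sum from + N · 1#                              ≈⟨ +-congˡ (Σ.sum-replicate N) ⟨
    Σ.sum from + Σ.sum {N} (λ _ → 1#)                ≈⟨ Σ.∑-distrib-+ from (λ _ → 1#) ⟨
    Σ.sum (λ i → from i + 1#)                        ≈⟨ Σ.sum-cong-≋ (λ i → strictlyInverseʳ (from i + 1#)) ⟨
    Σ.sum (λ i → from (to (from i + 1#)))            ≈⟨ Σ.sum-permute from shift ⟨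
    Σ.sum from                                       ≈⟨ +-identityʳ _ ⟨
    Σ.sum from + 0#                                  ∎)
    where
    shift : Permutation N N
    shift = onIndices {g = _+ 1#} +-congʳ (+-cancelʳ _ _ _)

  module Fermat (integral : ∀ {x y} → x * y ≈ 0# → x ≈ 0# ⊎ y ≈ 0#) (1≉0 : 1# ≉ 0#) where

    *-cancelʳ : ∀ {x y z} → z ≉ 0# → x * z ≈ y * z → x ≈ y
    *-cancelʳ {x} {y} {z} z≉0 eq with integral (begin
        (x - y) * z      ≈⟨ [y-z]x≈yx-zx z x y ⟩
        x * z - y * z    ≈⟨ +-congʳ eq ⟩
        y * z - y * z    ≈⟨ -‿inverseʳ _ ⟩
        0#               ∎)
    ... | inj₁ x-y≈0 = x-y≈0⇒x≈y x y x-y≈0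
    ... | inj₂ z≈0   = contradiction z≈0 z≉0

    -- Replacing 0 by 1 makes the product over the whole field the product of
    -- its units.
    unit : Carrier → Carrier
    unit x with x ≟ 0#
    ... | yes _ = 1#
    ... | no  _ = x

    unit≉0 : ∀ x → unit x ≉ 0#
    unit≉0 x with x ≟ 0#
    ... | yes _  = 1≉0
    ... | no x≉0 = x≉0

    unit-cong : ∀ {x y} → x ≈ y → unit x ≈ unit y
    unit-cong {x} {y} x≈y with x ≟ 0# | y ≟ 0#
    ... | yes _   | yes _   = refl
    ... | yes x≈0 | no y≉0  = contradiction (trans (sym x≈y) x≈0) y≉0
    ... | no x≉0  | yes y≈0 = contradiction (trans x≈y y≈0) x≉0
    ... | no _    | no _    = x≈y

    product≉0 : ∀ {n} (t : Fin n → Carrier) → (∀ i → t i ≉ 0#) → Π.sum t ≉ 0#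
    product≉0 {zero}  t t≉0 = 1≉0
    product≉0 {suc n} t t≉0 Πt≈0 with integral Πt≈0
    ... | inj₁ t₀≈0 = t≉0 zero t₀≈0
    ... | inj₂ rest = product≉0 (t ∘ suc) (t≉0 ∘ suc) rest

    -- The factor that `unit` picks up under multiplication by `a`. It is `1#` at zero, where `unit`
    -- stays equal to `1#`.
    scale : Carrier → Carrier → Carrier
    scale a x with x ≟ 0#
    ... | yes _ = 1#
    ... | no  _ = a

    scale-0 : ∀ a {x} → x ≈ 0# → scale a x ≈ 1#
    scale-0 a {x} x≈0 with x ≟ 0#
    ... | yes _  = refl
    ... | no x≉0 = contradiction x≈0 x≉0

    scale-≉0 : ∀ a {x} → x ≉ 0# → scale a x ≈ a
    scale-≉0 a {x} x≉0 with x ≟ 0#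
    ... | yes x≈0 = contradiction x≈0 x≉0
    ... | no _    = refl

    unit-* : ∀ {a} → a ≉ 0# → ∀ x → unit (a * x) ≈ scale a x * unit x
    unit-* {a} a≉0 x with x ≟ 0# | (a * x) ≟ 0#
    ... | yes _   | yes _    = sym (*-identityˡ 1#)
    ... | yes x≈0 | no ax≉0  = contradiction (trans (*-congˡ x≈0) (zeroʳ a)) ax≉0
    ... | no x≉0  | yes ax≈0 = contradiction (integral ax≈0) [ a≉0 , x≉0 ]′
    ... | no _    | no _     = refl

    product-allBut : ∀ {n} (t : Fin n → Carrier) a i → t i ≈ 1# → (∀ j → j ≢ i → t j ≈ a) →
                     a * Π.sum t ≈ a ^ n
    product-allBut {suc n} t a i ti≈1 t≈a = *-congˡ (begin
      Π.sum t                        ≈⟨ Π.sum-remove {i = i} t ⟩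
      t i * Π.sum (removeAt t i)     ≈⟨ *-cong ti≈1 (Π.sum-cong-≋ (λ j → t≈a (punchIn i j) (Fin.punchInᵢ≢i i j))) ⟩
      1# * Π.sum {n} (λ _ → a)       ≈⟨ *-identityˡ _ ⟩
      Π.sum {n} (λ _ → a)            ≈⟨ Π.sum-replicate n ⟩
      a ^ n                          ∎)

    -- Multiplication by a nonzero `a` permutes the field, so the rescaled product of units equals
    -- the original one, which is nonzero and cancels.
    product-scale : ∀ {a} → a ≉ 0# → Π.sum (scale a ∘ from) ≈ 1#
    product-scale {a} a≉0 = *-cancelʳ (product≉0 (unit ∘ from) (unit≉0 ∘ from)) (begin
      Π.sum (scale a ∘ from) * Π.sum (unit ∘ from)
        ≈⟨ Π.∑-distrib-+ (scale a ∘ from) (unit ∘ from) ⟨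
      Π.sum (λ i → scale a (from i) * unit (from i))
        ≈⟨ Π.sum-cong-≋ (λ i → unit-* a≉0 (from i)) ⟨
      Π.sum (λ i → unit (a * from i))
        ≈⟨ Π.sum-cong-≋ (λ i → unit-cong (strictlyInverseʳ (a * from i))) ⟨
      Π.sum (λ i → unit (from (to (a * from i))))
        ≈⟨ Π.sum-permute (unit ∘ from) multiply ⟨
      Π.sum (unit ∘ from)
        ≈⟨ *-identityˡ _ ⟨
      1# * Π.sum (unit ∘ from) ∎)
      where
      multiply : Permutation N N
      multiply = onIndices {g = a *_} *-congˡ
        (λ {x} {y} eq → *-cancelʳ a≉0 (trans (*-comm x a) (trans eq (*-comm a y))))

    -- The element of `Fin n` serves as evidence that `n` is positive.
    0^N≈0 : ∀ {n} → Fin n → 0# ^ n ≈ 0#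
    0^N≈0 {suc n} _ = zeroˡ _

    fermat : ∀ a → a ^ N ≈ a
    fermat a with a ≟ 0#
    ... | yes a≈0 = begin
      a ^ N   ≈⟨ ^-congˡ N a≈0 ⟩
      0# ^ N  ≈⟨ 0^N≈0 (to 0#) ⟩
      0#      ≈⟨ a≈0 ⟨
      a       ∎
    ... | no a≉0 = begin
      a ^ N                        ≈⟨ product-allBut (scale a ∘ from) a (to 0#)
                                        (scale-0 a (strictlyInverseʳ 0#))
                                        (λ j j≢ → scale-≉0 a (λ fj≈0 →
                                          j≢ (≡.trans (≡.sym (strictlyInverseˡ j)) (to-cong fj≈0)))) ⟨
      a * Π.sum (scale a ∘ from)   ≈⟨ *-congˡ (product-scale a≉0) ⟩
      a * 1#                       ≈⟨ *-identityʳ a ⟩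
      a                            ∎

-- Polynomial identities in characteristic 2.

HasCharacteristic2 : CommutativeRing c ℓ₁ → Set ℓ₁
HasCharacteristic2 R = 1# + 1# ≈ 0#
  where open CommutativeRing R

module Characteristic2 (R : CommutativeRing c ℓ₁) (1+1≈0 : HasCharacteristic2 R) where

  open CommutativeRing R hiding (zero)
  open Exp semiring using (_^_; ^-congˡ; ^-assocʳ)
  open SetoidReasoning setoid

  private
    -- Negation is the identity in characteristic 2.
    almostCommutativeRing : AlmostCommutativeRing _ _
    almostCommutativeRing = fromCommutativeSemiring commutativeSemiring

    -- Solver coefficients are Booleans under xor and conjunction, so normal forms are reduced
    -- modulo 2.
    𝔽₂ = CommutativeRing.rawRing Bool.xor-∧-commutativeRing

    ⟦_⟧₂ : Bool → Carrier
    ⟦ b ⟧₂ = if b then 1# else 0#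

    𝔽₂⟶R : 𝔽₂ -Raw-AlmostCommutative⟶ almostCommutativeRing
    𝔽₂⟶R = record
      { ⟦_⟧    = ⟦_⟧₂
      ; +-homo = λ { false b     → sym (+-identityˡ _)
                   ; true  false → sym (+-identityʳ _)
                   ; true  true  → sym 1+1≈0 }
      ; *-homo = λ { false b → sym (zeroˡ _) ; true b → sym (*-identityˡ _) }
      ; -‿homo = λ _ → refl
      ; 0-homo = refl
      ; 1-homo = refl
      }

    _≟₂_ : ∀ a b → Maybe (⟦ a ⟧₂ ≈ ⟦ b ⟧₂)
    a ≟₂ b with a Bool.≟ b
    ... | yes a≡b = just (reflexive (≡.cong ⟦_⟧₂ a≡b))
    ... | no  _   = nothing

  open RingSolver 𝔽₂ almostCommutativeRing 𝔽₂⟶R _≟₂_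
    using (Polynomial; solve; con; _:=_; _:+_; _:*_; _:^_)

  x+x≈0 : ∀ x → x + x ≈ 0#
  x+x≈0 = solve 1 (λ x → x :+ x := con false) refl

  x+y≈0⇒x≈y : ∀ {x y} → x + y ≈ 0# → x ≈ y
  x+y≈0⇒x≈y {x} {y} x+y≈0 = begin
    x            ≈⟨ solve 2 (λ x y → x := (x :+ y) :+ y) refl x y ⟩
    (x + y) + y  ≈⟨ +-congʳ x+y≈0 ⟩
    0# + y       ≈⟨ +-identityˡ y ⟩
    y            ∎

  *-zero : ∀ x {y} → y ≈ 0# → x * y ≈ 0#
  *-zero x y≈0 = trans (*-congˡ y≈0) (zeroʳ x)

  +-zero : ∀ {x y} → x ≈ 0# → y ≈ 0# → x + y ≈ 0#
  +-zero x≈0 y≈0 = trans (+-cong x≈0 y≈0) (+-identityˡ 0#)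

  -- Induction by squaring: the cross terms of `(x + y) ^ 2` cancel.
  frobenius-+ : ∀ k x y → (x + y) ^ (2 ℕ.^ k) ≈ x ^ (2 ℕ.^ k) + y ^ (2 ℕ.^ k)
  frobenius-+ zero    x y = solve 2 (λ x y → (x :+ y) :^ 1 := x :^ 1 :+ y :^ 1) refl x y
  frobenius-+ (suc k) x y = begin
    (x + y) ^ (2 ℕ.^ suc k)                    ≈⟨ ^-assocʳ (x + y) 2 (2 ℕ.^ k) ⟨
    ((x + y) ^ 2) ^ (2 ℕ.^ k)                  ≈⟨ ^-congˡ (2 ℕ.^ k) (solve 2 (λ x y → (x :+ y) :^ 2 := x :^ 2 :+ y :^ 2) refl x y) ⟩
    (x ^ 2 + y ^ 2) ^ (2 ℕ.^ k)                ≈⟨ frobenius-+ k (x ^ 2) (y ^ 2) ⟩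
    (x ^ 2) ^ (2 ℕ.^ k) + (y ^ 2) ^ (2 ℕ.^ k)  ≈⟨ +-cong (^-assocʳ x 2 (2 ℕ.^ k)) (^-assocʳ y 2 (2 ℕ.^ k)) ⟩
    x ^ (2 ℕ.^ suc k) + y ^ (2 ℕ.^ suc k)      ∎

  -- Functions given by a monic polynomial of the stated degree, in Horner form.
  data Monic : ℕ → (Carrier → Carrier) → Set (c ⊔ ℓ₁) where
    one  : ∀ {f} → (∀ x → f x ≈ 1#) → Monic 0 f
    step : ∀ {d f g} b → Monic d g → (∀ x → f x ≈ x * g x + b) → Monic (suc d) f

  -- Synthetic division by `x - r`, written `x + r` in characteristic 2. The Horner coefficients of
  -- the quotient are values at `r` of the successive inner polynomials, and the remainder is `f r`.
  factor : ∀ {d f} → Monic (suc d) f → ∀ r →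
           ∃[ g ] Monic d g × (∀ x → f x ≈ (x + r) * g x + f r)
  factor {f = f} (step {g = g} b (one g≈1) f≈) r = (λ _ → 1#) , one (λ _ → refl) , λ x → begin
    f x                           ≈⟨ f≈ x ⟩
    x * g x + b                   ≈⟨ +-congʳ (*-congˡ (g≈1 x)) ⟩
    x * 1# + b                    ≈⟨ solve 3 (λ x r b → x :* con true :+ b := (x :+ r) :* con true :+ (r :* con true :+ b)) refl x r b ⟩
    (x + r) * 1# + (r * 1# + b)   ≈⟨ +-congˡ (trans (f≈ r) (+-congʳ (*-congˡ (g≈1 r)))) ⟨
    (x + r) * 1# + f r            ∎
  factor {f = f} (step {g = g} b m@(step _ _ _) f≈) r with factor m r
  ... | h , h-monic , g≈ = (λ x → x * h x + g r) , step (g r) h-monic (λ _ → refl) , λ x → begin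
    f x                                      ≈⟨ f≈ x ⟩
    x * g x + b                              ≈⟨ +-congʳ (*-congˡ (g≈ x)) ⟩
    x * ((x + r) * h x + g r) + b            ≈⟨ solve 5 (λ x r h g b → x :* ((x :+ r) :* h :+ g) :+ b := (x :+ r) :* (x :* h :+ g) :+ (r :* g :+ b)) refl x r (h x) (g r) b ⟩
    (x + r) * (x * h x + g r) + (r * g r + b) ≈⟨ +-congˡ (f≈ r) ⟨
    (x + r) * (x * h x + g r) + f r          ∎

  power+constant-monic : ∀ d b → Monic (suc d) (λ x → x ^ suc d + b)
  power+constant-monic d b = step b (power d) (λ _ → refl)
    where
    power : ∀ d → Monic d (_^ d)
    power zero    = one (λ _ → refl)
    power (suc d) = step 0# (power d) (λ x → sym (+-identityʳ _))

  -- The cubic defining 𝔽₈ and the factorisation of the norm form.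

  minpoly : Carrier → Carrier
  minpoly t = t ^ 3 + t + 1#

  -- For a root α of minpoly, 1 + α + α² = α⁵, and the norm form below is
  -- N(x + α y + α⁵ z) from 𝔽₈ to 𝔽₂.
  line : Carrier → Carrier → Carrier → Carrier → Carrier
  line t x y z = x + t * y + (t ^ 2 + t + 1#) * z

  norm : Carrier → Carrier → Carrier → Carrier
  norm a b c = a ^ 3 + b ^ 3 + c ^ 3 + a ^ 2 * c + b ^ 2 * a + c ^ 2 * b + a * b * c

  line-cong : ∀ {t t′ x x′ y y′ z z′} → t ≈ t′ → x ≈ x′ → y ≈ y′ → z ≈ z′ →
              line t x y z ≈ line t′ x′ y′ z′
  line-cong t≈ x≈ y≈ z≈ =
    +-cong (+-cong x≈ (*-cong t≈ y≈)) (*-cong (+-congʳ (+-cong (^-congˡ 2 t≈) t≈)) z≈)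

  private
    :minpoly : ∀ {n} → Polynomial n → Polynomial n
    :minpoly t = t :^ 3 :+ t :+ con true

    :line : ∀ {n} → (t x y z : Polynomial n) → Polynomial n
    :line t x y z = x :+ t :* y :+ (t :^ 2 :+ t :+ con true) :* z

    :norm : ∀ {n} → (a b c : Polynomial n) → Polynomial n
    :norm a b c = a :^ 3 :+ b :^ 3 :+ c :^ 3 :+ a :^ 2 :* c :+ b :^ 2 :* a :+ c :^ 2 :* b :+ a :* b :* c

  -- Congruences modulo `minpoly t` are certified by an explicit quotient `q`, leaving an identity
  -- over 𝔽₂ for the solver.
  mod-minpoly : ∀ {t x y} q → minpoly t ≈ 0# → x ≈ y + q * minpoly t → x ≈ y
  mod-minpoly q root eq = trans eq (trans (+-congˡ (*-zero q root)) (+-identityʳ _))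

  minpoly-² : ∀ {t} → minpoly t ≈ 0# → minpoly (t ^ 2) ≈ 0#
  minpoly-² {t} root = trans
    (solve 1 (λ t → :minpoly (t :^ 2) := :minpoly t :* :minpoly t) refl t)
    (*-zero _ root)

  -- At a root, `t ^ 2 + t` is `t ^ 4`, the third conjugate. The multiplier is the other irreducible
  -- cubic over 𝔽₂.
  minpoly-²+ : ∀ {t} → minpoly t ≈ 0# → minpoly (t ^ 2 + t) ≈ 0#
  minpoly-²+ {t} root = trans
    (solve 1 (λ t → :minpoly (t :^ 2 :+ t) := (t :^ 3 :+ t :^ 2 :+ con true) :* :minpoly t) refl t)
    (*-zero _ root)

  t^8≈t : ∀ {t} → minpoly t ≈ 0# → t ^ 8 ≈ t
  t^8≈t {t} root = mod-minpoly _ root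
    (solve 1 (λ t → t :^ 8 := t :+ (t :^ 5 :+ t :^ 3 :+ t :^ 2 :+ t) :* :minpoly t) refl t)

  -- The two irreducible cubics over 𝔽₂ are exchanged by `x ↦ x + 1`, so a nontrivial seventh root
  -- of unity, or its translate by `1#`, is a root of `minpoly`.
  x^7+1 : ∀ x → x ^ 7 + 1# ≈ (x + 1#) * (minpoly x * minpoly (x + 1#))
  x^7+1 = solve 1 (λ x → x :^ 7 :+ con true := (x :+ con true) :* (:minpoly x :* :minpoly (x :+ con true))) refl

  -- The factors are the conjugates of one linear form under `t ↦ t ^ 2`, with `t ^ 4` reduced to
  -- `t ^ 2 + t`.
  norm-factor : ∀ {t} a b c → minpoly t ≈ 0# →
                norm a b c ≈ line t a b c * (line (t ^ 2) a b c * line (t ^ 2 + t) a b c)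
  norm-factor {t} a b c root = mod-minpoly _ root (solve 4 (λ t x y z →
    :norm x y z := :line t x y z :* (:line (t :^ 2) x y z :* :line (t :^ 2 :+ t) x y z) :+
      ((t :+ con true) :* x :* y :* y :+
       (t :^ 2 :+ t :+ con true) :* x :* y :* z :+
       (t :^ 5 :+ t :+ con true) :* x :* z :* z :+
       (t :^ 2 :+ t :+ con true) :* y :* y :* y :+
       t :^ 2 :* y :* y :* z :+
       (t :^ 6 :+ t :^ 4 :+ t :^ 2 :+ t :+ con true) :* y :* z :* z :+
       (t :^ 7 :+ t :^ 6 :+ t :^ 5 :+ t :^ 2) :* z :* z :* z)
      :* :minpoly t) refl t a b c)

  -- The case where σ fixes `t`. The multipliers are the cofactors of the `x` column divided by the
  -- determinant `t ^ 6`, that is, multiplied by `t`.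
  lines-fixed : ∀ {t} x y z → minpoly t ≈ 0# →
    line t x y z ≈ 0# → line t y z x ≈ 0# → line t z x y ≈ 0# → x ≈ 0#
  lines-fixed {t} x y z root l₁ l₂ l₃ = trans
    (mod-minpoly _ root (solve 4 (λ t x y z →
      x := (t :+ con true) :* :line t x y z :+ t :* :line t y z x :+ (t :^ 2 :+ t) :* :line t z x y
        :+ (t :* y :+ z) :* :minpoly t) refl t x y z))
    (+-zero (+-zero (*-zero _ l₁) (*-zero _ l₂)) (*-zero _ l₃))

  -- The case where σ squares `t`. The determinant is 1, so the multipliers are the cofactors of the
  -- `x` column themselves, reduced modulo `minpoly t`.
  lines-frobenius : ∀ {t} x y z → minpoly t ≈ 0# →
    line t x y z ≈ 0# → line (t ^ 2) y z x ≈ 0# → line ((t ^ 2) ^ 2) z x y ≈ 0# → x ≈ 0#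
  lines-frobenius {t} x y z root l₁ l₂ l₃ = trans
    (mod-minpoly _ root (solve 4 (λ t x y z →
      x := (t :+ con true) :* :line t x y z :+ t :^ 2 :* :line (t :^ 2) y z x :+ t :^ 2 :* :line ((t :^ 2) :^ 2) z x y
        :+ (t :* x :+ (t :^ 7 :+ t :^ 5 :+ t :^ 4 :+ t) :* y :+ (t :+ con true) :* z) :* :minpoly t) refl t x y z))
    (+-zero (+-zero (*-zero _ l₁) (*-zero _ l₂)) (*-zero _ l₃))

  -- The map L above, with (a, b, c) and (u, v, w) standing for the σ-orbits of
  -- ε and of the argument.
  derivative : (a b c u v w : Carrier) → Carrier
  derivative a b c u v w = (a + b) * u + (a + c) * v + b * w

  derivative-cong : ∀ {a a′ b b′ c c′ u u′ v v′ w w′} →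
    a ≈ a′ → b ≈ b′ → c ≈ c′ → u ≈ u′ → v ≈ v′ → w ≈ w′ →
    derivative a b c u v w ≈ derivative a′ b′ c′ u′ v′ w′
  derivative-cong a b c u v w = +-cong (+-cong (*-cong (+-cong a b) u) (*-cong (+-cong a c) v)) (*-cong b w)

  -- The multipliers are the cofactors of the first column.
  norm-determinant : ∀ a b c u v w →
    derivative a b c u v w ≈ 0# → derivative b c a v w u ≈ 0# → derivative c a b w u v ≈ 0# →
    norm a b c * u ≈ 0#
  norm-determinant a b c u v w d₁ d₂ d₃ = trans
    (solve 6 (λ a b c u v w →
      let d = λ a b c u v w → (a :+ b) :* u :+ (a :+ c) :* v :+ b :* w in
      :norm a b c :* u :=
        ((b :+ c) :* (a :+ c) :+ a :* (a :+ b)) :* d a b c u v w :+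
        ((a :+ c) :* (a :+ c) :+ a :* b) :* d b c a v w u :+
        ((a :+ c) :* (a :+ b) :+ b :* (b :+ c)) :* d c a b w u v) refl a b c u v w)
    (+-zero (+-zero (*-zero _ d₁) (*-zero _ d₂)) (*-zero _ d₃))

  -- The local `Δ` is the difference map with `(x, y, z)` in place of the σ-orbit of its argument.
  -- It is affine, so adding two values cancels the constant part.
  difference-derivative : ∀ a b c x y z x′ y′ z′ →
    let Δ = λ x y z → ((y + b) * (x + a) + (z + c) * (y + b)) + (y * x + z * y) + a * x in
    Δ x y z + Δ x′ y′ z′ ≈ derivative a b c (x + x′) (y + y′) (z + z′)
  difference-derivative = solve 9 (λ a b c x y z x′ y′ z′ →
    let Δ = λ x y z → ((y :+ b) :* (x :+ a) :+ (z :+ c) :* (y :+ b)) :+ (y :* x :+ z :* y) :+ a :* x in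
    Δ x y z :+ Δ x′ y′ z′ :=
      (a :+ b) :* (x :+ x′) :+ (a :+ c) :* (y :+ y′) :+ b :* (z :+ z′)) refl

  ^8^k-fixes : ∀ k {t} → minpoly t ≈ 0# → t ^ (8 ℕ.^ k) ≈ t
  ^8^k-fixes zero    {t} root = *-identityʳ t
  ^8^k-fixes (suc k) {t} root = begin
    t ^ (8 ℕ.* 8 ℕ.^ k)  ≈⟨ ^-assocʳ t 8 (8 ℕ.^ k) ⟨
    (t ^ 8) ^ (8 ℕ.^ k)  ≈⟨ ^-congˡ (8 ℕ.^ k) (t^8≈t root) ⟩
    t ^ (8 ℕ.^ k)        ≈⟨ ^8^k-fixes k root ⟩
    t                    ∎

  -- Eighth powers fix `t`, so only `m` modulo 3 matters. Residue 2 would send `t` to `t ^ 4`, for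
  -- which the system of conjugate lines is singular.
  frobenius-minpoly : ∀ m → m % 3 ≢ 2 → ∀ {t} → minpoly t ≈ 0# →
                      t ^ (2 ℕ.^ m) ≈ t ⊎ t ^ (2 ℕ.^ m) ≈ t ^ 2
  frobenius-minpoly m m%3≢2 {t} root with m % 3 | m / 3 | m≡m%n+[m/n]*n m 3 | m%n<n m 3
  ... | 0 | k | ≡.refl | _ rewrite ℕ.*-comm k 3 | ≡.sym (ℕ.^-*-assoc 2 3 k) =
    inj₁ (^8^k-fixes k root)
  ... | 1 | k | ≡.refl | _ rewrite ℕ.*-comm k 3 | ≡.sym (ℕ.^-*-assoc 2 3 k) =
    inj₂ (trans (sym (^-assocʳ t 2 (8 ℕ.^ k))) (^8^k-fixes k (minpoly-² root)))
  ... | 2 | _ | _ | _ = contradiction ≡.refl m%3≢2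
  ... | suc (suc (suc _)) | _ | _ | ℕ.s≤s (ℕ.s≤s (ℕ.s≤s ()))

  -- Roots of polynomials over an integral domain.

  module Integral (integral : ∀ {x y} → x * y ≈ 0# → x ≈ 0# ⊎ y ≈ 0#) where

    -- Dividing by the first root leaves a monic quotient that vanishes at the others; the descent
    -- ends at the constant `1#`, which still has a root.
    monic-roots : ∀ {d f} → Monic d f → (r : Fin (suc d) → Carrier) → Injective _≡_ _≈_ r →
                  (∀ i → f (r i) ≈ 0#) → 1# ≈ 0#
    monic-roots (one f≈1) r inj root = trans (sym (f≈1 (r zero))) (root zero)
    monic-roots {suc d} {f} m@(step _ _ _) r inj root with factor m (r zero)
    ... | g , g-monic , f≈ =
      monic-roots g-monic (r ∘ suc) (Fin.suc-injective ∘ inj) root′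
      where
      root′ : ∀ i → g (r (suc i)) ≈ 0#
      root′ i with integral (begin
          (r (suc i) + r zero) * g (r (suc i))               ≈⟨ +-identityʳ _ ⟨
          (r (suc i) + r zero) * g (r (suc i)) + 0#          ≈⟨ +-congˡ (root zero) ⟨
          (r (suc i) + r zero) * g (r (suc i)) + f (r zero)  ≈⟨ f≈ (r (suc i)) ⟨
          f (r (suc i))                                      ≈⟨ root (suc i) ⟩
          0#                                                 ∎)
      ... | inj₁ eq = contradiction (inj (x+y≈0⇒x≈y eq)) λ ()
      ... | inj₂ eq = eq

    minpoly-root : ∀ {t} → t ≉ 1# → t ^ 7 ≈ 1# → ∃[ α ] minpoly α ≈ 0#
    minpoly-root {t} t≉1 t⁷≈1 =
      [ (λ t+1≈0 → contradiction (x+y≈0⇒x≈y t+1≈0) t≉1)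
      , [ t ,_ , (t + 1#) ,_ ]′ ∘ integral
      ]′ (integral (begin
        (t + 1#) * (minpoly t * minpoly (t + 1#))  ≈⟨ x^7+1 t ⟨
        t ^ 7 + 1#                                 ≈⟨ +-congʳ t⁷≈1 ⟩
        1# + 1#                                    ≈⟨ 1+1≈0 ⟩
        0#                                         ∎))

    -- Injectivity of the linear part under an automorphism with trivial cube.

    module CubicAutomorphism (σ : Carrier → Carrier) (σ-cong : Congruent _≈_ _≈_ σ)
      (σ-+ : ∀ x y → σ (x + y) ≈ σ x + σ y) (σ-* : ∀ x y → σ (x * y) ≈ σ x * σ y)
      (σ-1 : σ 1# ≈ 1#) (σ³≈id : ∀ x → σ (σ (σ x)) ≈ x)
      (σ-minpoly : ∀ {t} → minpoly t ≈ 0# → σ t ≈ t ⊎ σ t ≈ t ^ 2) where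

      σ-0 : ∀ {x} → x ≈ 0# → σ x ≈ 0#
      σ-0 {x} x≈0 = begin
        σ x          ≈⟨ σ-cong (trans x≈0 (sym (x+x≈0 0#))) ⟩
        σ (0# + 0#)  ≈⟨ σ-+ 0# 0# ⟩
        σ 0# + σ 0#  ≈⟨ x+x≈0 (σ 0#) ⟩
        0#           ∎

      σ-² : ∀ x → σ (x ^ 2) ≈ σ x ^ 2
      σ-² x = trans (σ-* x (x * 1#)) (*-congˡ (trans (σ-* x 1#) (*-congˡ σ-1)))

      σ-+* : ∀ x y z → σ (x + y * z) ≈ σ x + σ y * σ z
      σ-+* x y z = trans (σ-+ x (y * z)) (+-congˡ (σ-* y z))

      σ-line : ∀ t x y z → σ (line t x y z) ≈ line (σ t) (σ x) (σ y) (σ z)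
      σ-line t x y z = trans (σ-+* _ _ z) (+-cong (σ-+* x t y) (*-congʳ
        (trans (σ-+ _ 1#) (+-cong (trans (σ-+ (t ^ 2) t) (+-congʳ (σ-² t))) σ-1))))

      σ-derivative : ∀ a b c u v w →
        σ (derivative a b c u v w) ≈ derivative (σ a) (σ b) (σ c) (σ u) (σ v) (σ w)
      σ-derivative a b c u v w = trans (σ-+* _ b w) (+-congʳ
        (trans (σ-+* _ (a + c) v) (+-cong
          (trans (σ-* (a + b) u) (*-congʳ (σ-+ a b)))
          (*-congʳ (σ-+ a c)))))

      σ-line≈0 : ∀ {t t′ x y z} → σ t ≈ t′ → line t x y z ≈ 0# → line t′ (σ x) (σ y) (σ z) ≈ 0#
      σ-line≈0 {t} {t′} {x} {y} {z} σt≈t′ l = begin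
        line t′ (σ x) (σ y) (σ z)     ≈⟨ line-cong σt≈t′ refl refl refl ⟨
        line (σ t) (σ x) (σ y) (σ z)  ≈⟨ σ-line t x y z ⟨
        σ (line t x y z)              ≈⟨ σ-0 l ⟩
        0#                            ∎

      σ-derivative≈0 : ∀ {a b c u v w} → derivative a b c u v w ≈ 0# →
                       derivative (σ a) (σ b) (σ c) (σ u) (σ v) (σ w) ≈ 0#
      σ-derivative≈0 {a} {b} {c} {u} {v} {w} d = trans (sym (σ-derivative a b c u v w)) (σ-0 d)

      -- Applying σ shifts the orbit of `x` cyclically, with σ³ = id closing the cycle, while the
      -- coefficients move along `t`, `t′`, `t″`.
      conjugate-lines : ∀ {t t′ t″} x → σ t ≈ t′ → σ t′ ≈ t″ → line t x (σ x) (σ (σ x)) ≈ 0# →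
        line t′ (σ x) (σ (σ x)) x ≈ 0# × line t″ (σ (σ x)) x (σ x) ≈ 0#
      conjugate-lines {t} {t′} {t″} x σt≈t′ σt′≈t″ l₁ = l₂ , l₃
        where
        l₂ : line t′ (σ x) (σ (σ x)) x ≈ 0#
        l₂ = trans (line-cong refl refl refl (sym (σ³≈id x))) (σ-line≈0 σt≈t′ l₁)
        l₃ : line t″ (σ (σ x)) x (σ x) ≈ 0#
        l₃ = trans (line-cong refl refl (sym (σ³≈id x)) refl) (σ-line≈0 σt′≈t″ l₂)

      line-injective : ∀ {t} → minpoly t ≈ 0# → ∀ x → line t x (σ x) (σ (σ x)) ≈ 0# → x ≈ 0#
      line-injective {t} root x l₁ = [ fixed , frobenius ]′ (σ-minpoly root)
        where
        fixed : σ t ≈ t → x ≈ 0#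
        fixed σt≈t = lines-fixed x (σ x) (σ (σ x)) root l₁ (proj₁ l₂₃) (proj₂ l₂₃)
          where l₂₃ = conjugate-lines x σt≈t σt≈t l₁
        frobenius : σ t ≈ t ^ 2 → x ≈ 0#
        frobenius σt≈t² = lines-frobenius x (σ x) (σ (σ x)) root l₁ (proj₁ l₂₃) (proj₂ l₂₃)
          where l₂₃ = conjugate-lines x σt≈t² (trans (σ-² t) (^-congˡ 2 σt≈t²)) l₁

      norm-anisotropic : ∀ {t} → minpoly t ≈ 0# → ∀ x → norm x (σ x) (σ (σ x)) ≈ 0# → x ≈ 0#
      norm-anisotropic {t} root x n≈0 =
        [ line-injective root x
        , [ line-injective (minpoly-² root) x , line-injective (minpoly-²+ root) x ]′ ∘ integral
        ]′ (integral (trans (sym (norm-factor x (σ x) (σ (σ x)) root)) n≈0))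

      -- Cramer's rule for the equation and its two conjugates gives `norm * u ≈ 0#`, and the norm
      -- at a nonzero `a` cannot vanish.
      derivative-injective : ∀ {t} → minpoly t ≈ 0# → ∀ {a} → a ≉ 0# → ∀ u →
        derivative a (σ a) (σ (σ a)) u (σ u) (σ (σ u)) ≈ 0# → u ≈ 0#
      derivative-injective root {a} a≉0 u d₁ =
        [ (λ n≈0 → contradiction (norm-anisotropic root a n≈0) a≉0) , (λ u≈0 → u≈0) ]′
        (integral (norm-determinant a (σ a) (σ (σ a)) u (σ u) (σ (σ u)) d₁ d₂ d₃))
        where
        d₂ : derivative (σ a) (σ (σ a)) a (σ u) (σ (σ u)) u ≈ 0#
        d₂ = trans (derivative-cong refl refl (sym (σ³≈id a)) refl refl (sym (σ³≈id u))) (σ-derivative≈0 d₁)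
        d₃ : derivative (σ (σ a)) a (σ a) (σ (σ u)) u (σ u) ≈ 0#
        d₃ = trans (derivative-cong refl (sym (σ³≈id a)) refl refl (sym (σ³≈id u)) refl) (σ-derivative≈0 d₂)

-- Integrality and characteristic of a binary field.

module BinaryFieldProperties {n : ℕ} (F : BinaryField c ℓ₁ ℓ₂ n) where

  open BinaryField F hiding (zero)
  private module H = HeytingField heytingField
  open FiniteRing commutativeRing enumeration public
  open RingProperties ring using (-0#≈0#)
  open SemiringMult semiring using (×1-homo-*) renaming (_×_ to _·_)
  open SetoidReasoning (CommutativeRing.setoid commutativeRing)

  1≉0 : 1# ≉ 0#
  -- If `1# ≈ 0#`, then `0# - 0#` is invertible, which would put `0#` apart from itself.
  1≉0 1≈0 = H.#-irrefl refl (H.invertible⇒# {0#} {0#}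
    (0# , trans (zeroˡ _) (sym 1≈0) , trans (zeroʳ _) (sym 1≈0)))

  #0⇒cancel : ∀ {x y} → x # 0# → x * y ≈ 0# → y ≈ 0#
  #0⇒cancel {x} {y} x#0 xy≈0 with H.#⇒invertible x#0
  ... | x⁻¹ , x⁻¹x≈1 , _ = begin
    y                    ≈⟨ *-identityˡ y ⟨
    1# * y               ≈⟨ *-congʳ x⁻¹x≈1 ⟨
    x⁻¹ * (x - 0#) * y   ≈⟨ *-congʳ (*-congˡ (trans (+-congˡ -0#≈0#) (+-identityʳ x))) ⟩
    x⁻¹ * x * y          ≈⟨ *-assoc x⁻¹ x y ⟩
    x⁻¹ * (x * y)        ≈⟨ *-congˡ xy≈0 ⟩
    x⁻¹ * 0#             ≈⟨ zeroʳ x⁻¹ ⟩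
    0#                   ∎

  integral : ∀ {x y} → x * y ≈ 0# → x ≈ 0# ⊎ y ≈ 0#
  integral {x} {y} xy≈0 with y ≟ 0#
  ... | yes y≈0 = inj₂ y≈0
  ... | no  y≉0 = inj₁ (proj₁ (H.tight x 0#) λ x#0 → y≉0 (#0⇒cancel x#0 xy≈0))

  -- The characteristic comes from the cardinality: `2 ^ k` copies of `1#` are a product of factors
  -- `1# + 1#`, one of which must vanish.
  2^k·1≈0⇒1+1≈0 : ∀ k → (2 ℕ.^ k) · 1# ≈ 0# → 1# + 1# ≈ 0#
  2^k·1≈0⇒1+1≈0 zero    eq = contradiction (trans (sym (+-identityʳ 1#)) eq) 1≉0
  2^k·1≈0⇒1+1≈0 (suc k) eq with integral (trans (sym (×1-homo-* 2 (2 ℕ.^ k))) eq)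
  ... | inj₁ 2·1≈0 = trans (+-congˡ (sym (+-identityʳ 1#))) 2·1≈0
  ... | inj₂ rest  = 2^k·1≈0⇒1+1≈0 k rest

  1+1≈0 : 1# + 1# ≈ 0#
  1+1≈0 = 2^k·1≈0⇒1+1≈0 n N·1≈0

  open Fermat integral 1≉0 public
  open Characteristic2 commutativeRing 1+1≈0 public
  open Integral integral public

-- A root of the cubic inside the field.

repunit₈ : ℕ → ℕ
repunit₈ zero    = 0
repunit₈ (suc k) = suc (8 ℕ.* repunit₈ k)

-- At `k = m` this writes the order of the unit group as `repunit₈ m * 7`, so `repunit₈ m`-th powers
-- of units are seventh roots of unity.
8^k≡1+repunit₈*7 : ∀ k → 8 ℕ.^ k ≡ suc (repunit₈ k ℕ.* 7)
8^k≡1+repunit₈*7 zero    = ≡.refl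
8^k≡1+repunit₈*7 (suc k) = ≡.trans (≡.cong (8 ℕ.*_) (8^k≡1+repunit₈*7 k))
  (solve 1 (λ r → con 8 :* (con 1 :+ r :* con 7) := con 1 :+ (con 1 :+ con 8 :* r) :* con 7) ≡.refl (repunit₈ k))
  where open +-*-Solver

module 𝔽₈-Subfield {m : ℕ} .{{_ : NonZero m}} (F : BinaryField c ℓ₁ ℓ₂ (3 ℕ.* m)) where

  open BinaryField F hiding (zero)
  open Inverse enumeration using (from; strictlyInverseʳ)
  open BinaryFieldProperties F
  open Exp semiring using (^-assocʳ; ^-congʳ)
  open SetoidReasoning (CommutativeRing.setoid commutativeRing)

  |F|≡1+repunit₈*7 : 2 ℕ.^ (3 ℕ.* m) ≡ suc (repunit₈ m ℕ.* 7)
  |F|≡1+repunit₈*7 = ≡.trans (≡.sym (ℕ.^-*-assoc 2 3 m)) (8^k≡1+repunit₈*7 m)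

  -- The monic polynomial `X ^ (r + 2) + X` would have at least `r + 3` roots.
  x*x^r≈x⇒1≈0 : ∀ r → suc (suc (suc r)) ℕ.≤ 2 ℕ.^ (3 ℕ.* m) →
               (∀ x → x * x ^ suc r ≈ x) → 1# ≈ 0#
  x*x^r≈x⇒1≈0 r r+3≤N all = monic-roots
    (step 0# (power+constant-monic r 1#) (λ _ → refl))
    (from ∘ λ i → inject≤ i r+3≤N)
    (λ eq → Fin.inject≤-injective r+3≤N r+3≤N _ _ (from-injective eq))
    (λ i → root (from (inject≤ i r+3≤N)))
    where
    root : ∀ x → x * (x ^ suc r + 1#) + 0# ≈ 0#
    root x = begin
      x * (x ^ suc r + 1#) + 0#   ≈⟨ +-identityʳ _ ⟩
      x * (x ^ suc r + 1#)        ≈⟨ distribˡ x _ _ ⟩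
      x * x ^ suc r + x * 1#      ≈⟨ +-cong (all x) (*-identityʳ x) ⟩
      x + x                       ≈⟨ x+x≈0 x ⟩
      0#                          ∎

  nontrivial-power : ∃[ x ] x * x ^ repunit₈ m ≉ x
  nontrivial-power with Fin.¬∀⟶∃¬ (2 ℕ.^ (3 ℕ.* m)) _ (λ i → from i * from i ^ repunit₈ m ≟ from i)
    (λ all → 1≉0 (collapse m (ℕ.≢-nonZero⁻¹ m) |F|≡1+repunit₈*7 all))
    where
    -- A separate `k` can be matched on while the degree of `F` stays expressed in `m`.
    collapse : ∀ k → k ≢ 0 → 2 ℕ.^ (3 ℕ.* m) ≡ suc (repunit₈ k ℕ.* 7) →
               (∀ i → from i * from i ^ repunit₈ k ≈ from i) → 1# ≈ 0#
    collapse zero    k≢0 _  _   = contradiction ≡.refl k≢0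
    collapse (suc k) _   eq all = x*x^r≈x⇒1≈0 (8 ℕ.* repunit₈ k)
      -- With `r = 8 * repunit₈ k`, the field has `8 + 7 * r` elements, at least the required
      -- `r + 3`.
      (≡.subst (suc (suc (suc (8 ℕ.* repunit₈ k))) ℕ.≤_) (≡.sym eq)
        (ℕ.s≤s (ℕ.s≤s (ℕ.s≤s (ℕ.≤-trans (ℕ.m≤m*n _ 7) (ℕ.m≤n+m _ 5))))))
      (λ x → begin
        x * x ^ suc (8 ℕ.* repunit₈ k)   ≈⟨ *-cong (strictlyInverseʳ x) (Exp.^-congˡ semiring (suc (8 ℕ.* repunit₈ k)) (strictlyInverseʳ x)) ⟨
        _                                ≈⟨ all _ ⟩
        _                                ≈⟨ strictlyInverseʳ x ⟩
        x                                ∎)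
  ... | i , ≉ = from i , ≉

  -- For the nonzero `x` found above, `x ^ repunit₈ m` differs from `1#`, and its seventh power is
  -- `1#` by Fermat after cancelling `x`.
  root : ∃[ α ] minpoly α ≈ 0#
  root with nontrivial-power
  ... | x , xt≉x = minpoly-root
    (λ t≈1 → xt≉x (trans (*-congˡ t≈1) (*-identityʳ x)))
    (*-cancelʳ x≉0 (begin
      (x ^ r) ^ 7 * x     ≈⟨ *-comm _ x ⟩
      x * (x ^ r) ^ 7     ≈⟨ *-congˡ (^-assocʳ x r 7) ⟩
      x ^ suc (r ℕ.* 7)   ≈⟨ ^-congʳ x |F|≡1+repunit₈*7 ⟨
      x ^ (2 ℕ.^ (3 ℕ.* m)) ≈⟨ fermat x ⟩
      x                   ≈⟨ *-identityˡ x ⟨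
      1# * x              ∎))
    where
    r = repunit₈ m
    x≉0 : x ≉ 0#
    x≉0 x≈0 = xt≉x (trans (*-congʳ x≈0) (trans (zeroˡ _) (sym x≈0)))

-- Pseudo-planarity.

proposition3p6 : ∀ {c ℓ₁ ℓ₂} (m : ℕ) .{{_ : NonZero m}} → m % 3 ≢ 2 →
    (F : BinaryField c ℓ₁ ℓ₂ (3 ℕ.* m)) →
    let open BinaryField F in
    PseudoPlanar F (λ x → x ^ (2 ℕ.^ m ℕ.+ 1) + x ^ (2 ℕ.^ (2 ℕ.* m) ℕ.+ 2 ℕ.^ m))
proposition3p6 m m%3≢2 F ε ε≉0 = record
  { isInjection = record
    { isCongruent = record
      { cong           = Δ-cong
      ; isEquivalence₁ = isEquivalence
      ; isEquivalence₂ = isEquivalence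
      }
    ; injective = Δ-injective
    }
  -- Injectivity suffices because the field is finite.
  ; surjective = injective⇒surjective Δ-cong Δ-injective
  }
  where
  open BinaryField F hiding (zero)
  open BinaryFieldProperties F
  open Exp semiring using (^-congˡ; ^-congʳ; ^-homo-*; ^-assocʳ)
  open CommutativeExp (CommutativeRing.commutativeSemiring commutativeRing) using (^-distrib-*)
  open SetoidReasoning (CommutativeRing.setoid commutativeRing)
  open 𝔽₈-Subfield {m = m} F using (root)

  q = 2 ℕ.^ m

  σ : Carrier → Carrier
  σ x = x ^ q

  2^[2*m]≡q*q : 2 ℕ.^ (2 ℕ.* m) ≡ q ℕ.* q
  2^[2*m]≡q*q = ≡.trans (≡.cong (2 ℕ.^_) (≡.cong (m ℕ.+_) (ℕ.+-identityʳ m))) (ℕ.^-distribˡ-+-* 2 m m)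

  σ³≈id : ∀ x → σ (σ (σ x)) ≈ x
  σ³≈id x = begin
    ((x ^ q) ^ q) ^ q        ≈⟨ ^-congˡ q (^-assocʳ x q q) ⟩
    (x ^ (q ℕ.* q)) ^ q      ≈⟨ ^-assocʳ x (q ℕ.* q) q ⟩
    x ^ (q ℕ.* q ℕ.* q)      ≈⟨ ^-congʳ x q³≡N ⟩
    x ^ (2 ℕ.^ (3 ℕ.* m))    ≈⟨ fermat x ⟩
    x                        ∎
    where
    q³≡N : q ℕ.* q ℕ.* q ≡ 2 ℕ.^ (3 ℕ.* m)
    q³≡N = ≡.sym (≡.trans (ℕ.^-distribˡ-+-* 2 m (2 ℕ.* m))
      (≡.trans (≡.cong (q ℕ.*_) 2^[2*m]≡q*q) (≡.sym (ℕ.*-assoc q q q))))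

  1^n≈1 : ∀ n → 1# ^ n ≈ 1#
  1^n≈1 zero    = refl
  1^n≈1 (suc n) = trans (*-identityˡ _) (1^n≈1 n)

  open CubicAutomorphism σ (^-congˡ q) (frobenius-+ m) (λ x y → ^-distrib-* x y q)
    (1^n≈1 q) σ³≈id (frobenius-minpoly m m%3≢2)

  f Δ : Carrier → Carrier
  f x = x ^ (2 ℕ.^ m ℕ.+ 1) + x ^ (2 ℕ.^ (2 ℕ.* m) ℕ.+ 2 ℕ.^ m)
  Δ x = f (x + ε) + f x + ε * x

  f-cong : Congruent _≈_ _≈_ f
  f-cong x≈y = +-cong (^-congˡ (q ℕ.+ 1) x≈y) (^-congˡ (2 ℕ.^ (2 ℕ.* m) ℕ.+ q) x≈y)

  Δ-cong : Congruent _≈_ _≈_ Δ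
  Δ-cong x≈y = +-cong (+-cong (f-cong (+-congʳ x≈y)) (f-cong x≈y)) (*-congˡ x≈y)

  f-σ : ∀ x → f x ≈ σ x * x + σ (σ x) * σ x
  f-σ x = +-cong
    (trans (^-homo-* x q 1) (*-congˡ (*-identityʳ x)))
    (trans (^-homo-* x (2 ℕ.^ (2 ℕ.* m)) q)
      (*-congʳ (trans (^-congʳ x 2^[2*m]≡q*q) (sym (^-assocʳ x q q)))))

  σσ-+ : ∀ x y → σ (σ (x + y)) ≈ σ (σ x) + σ (σ y)
  σσ-+ x y = trans (^-congˡ q (frobenius-+ m x y)) (frobenius-+ m (σ x) (σ y))

  Δ-σ : ∀ x → Δ x ≈ ((σ x + σ ε) * (x + ε) + (σ (σ x) + σ (σ ε)) * (σ x + σ ε))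
                      + (σ x * x + σ (σ x) * σ x) + ε * x
  Δ-σ x = +-congʳ (+-cong
    (trans (f-σ (x + ε)) (+-cong (*-congʳ (frobenius-+ m x ε))
                                 (*-cong (σσ-+ x ε) (frobenius-+ m x ε))))
    (f-σ x))

  Δ-injective : Injective _≈_ _≈_ Δ
  -- Equal values have sum zero, and that sum is the linear part at `x + y`; its injectivity gives
  -- `x + y ≈ 0#`, hence `x ≈ y`.
  Δ-injective {x} {y} Δx≈Δy = x+y≈0⇒x≈y (derivative-injective (proj₂ root) ε≉0 (x + y) (begin
    derivative ε (σ ε) (σ (σ ε)) (x + y) (σ (x + y)) (σ (σ (x + y)))
      ≈⟨ derivative-cong refl refl refl refl (frobenius-+ m x y) (σσ-+ x y) ⟩
    derivative ε (σ ε) (σ (σ ε)) (x + y) (σ x + σ y) (σ (σ x) + σ (σ y))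
      ≈⟨ difference-derivative ε (σ ε) (σ (σ ε)) x (σ x) (σ (σ x)) y (σ y) (σ (σ y)) ⟨
    _ ≈⟨ +-cong (Δ-σ x) (Δ-σ y) ⟨
    Δ x + Δ y  ≈⟨ +-congʳ Δx≈Δy ⟩
    Δ y + Δ y  ≈⟨ x+x≈0 (Δ y) ⟩
    0#         ∎))
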